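{- If $k\ge 3$ is odd then there exists a maximal $\mathcal{NAS}_k(2)$.
   Context: For a sequence $S=(s_i)_{i\ge0}$ with entries in $\mathbb{Z}_k$ write $\mathbf{s}_n(i)=(s_i,\dots,s_{i+n-1})$; an $n$-tuple occurs in $S$ if it equals $\mathbf{s}_n(i)$ for some $i$. A $k$-ary $n$-window sequence is a periodic sequence over $\mathbb{Z}_k$, of period $m$ say, such that $\mathbf{s}_n(i)=\mathbf{s}_n(j)$ implies $i\equiv j\pmod m$. For $k\ge3$, $n\ge2$, an $\mathcal{NAS}_k(n)$ ($k$-ary Negative Avoiding Sequence of span $n$) is a $k$-ary $n$-window sequence $S$ such that whenever an $n$-tuple $\mathbf{a}=(a_0,\dots,a_{n-1})$ occurs in $S$, its negative $-\mathbf{a}=(-a_0,\dots,-a_{n-1})$ does not occur in $S$. An $\mathcal{NAS}_k(n)$ is maximal if its period equals $\frac{k^n-1}{2}$ when $k$ is odd, or $\frac{k^n-2^n}{2}$ when $k$ is even. -}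

module Defs where

open import Data.Nat using (ℕ; suc; _+_; _∸_; _^_; _<_; _/_; ∣_-_∣)
open import Data.Nat.Divisibility using (_∣_)
open import Data.Nat.DivMod using (_mod_)
open import Data.Fin using (Fin; toℕ)
open import Data.Vec using (Vec; tabulate; map)
open import Data.Product using (∃-syntax; _×_)
open import Relation.Binary.PropositionalEquality using (_≡_)
open import Relation.Nullary using (¬_)

Odd : ℕ → Set
Odd k = ¬ (2 ∣ k)

-- ℤ_k is represented by Fin k, an element standing for the residue class of
-- its toℕ.
ℤmod : ℕ → Set
ℤmod = Fin

neg : ∀ {k} → ℤmod k → ℤmod k
neg {suc k} a = (suc k ∸ toℕ a) mod suc k

Sequence : ℕ → Set
Sequence k = ℕ → ℤmod k

_≡_[mod_] : ℕ → ℕ → ℕ → Set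
i ≡ j [mod m ] = m ∣ ∣ i - j ∣

tuple : ∀ {k} n → Sequence k → ℕ → Vec (ℤmod k) n
tuple n S i = tabulate λ j → S (i + toℕ j)

_OccursIn_ : ∀ {k n} → Vec (ℤmod k) n → Sequence k → Set
_OccursIn_ {n = n} a S = ∃[ i ] a ≡ tuple n S i

-- m is not required to be the least period, but is so by the window property:
-- if p is a period then tuple n S p ≡ tuple n S 0, hence m ∣ p.
record IsWindowSequence {k} (n m : ℕ) (S : Sequence k) : Set where
  field
    period-positive : 0 < m
    periodic        : ∀ i → S (i + m) ≡ S i
    window          : ∀ i j → tuple n S i ≡ tuple n S j → i ≡ j [mod m ]

record IsNAS {k} (n m : ℕ) (S : Sequence k) : Set where
  field
    isWindowSequence : IsWindowSequence n m S
    negativeAvoiding : ∀ (a : Vec (ℤmod k) n) →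
                       a OccursIn S → ¬ (map neg a OccursIn S)

-- Both halvings are exact, as k ^ n and 1 (respectively k ^ n and 2 ^ n, for
-- 1 ≤ n) have the same parity.
IsMaximalPeriod : (k n m : ℕ) → Set
IsMaximalPeriod k n m =
  (Odd k → m ≡ (k ^ n ∸ 1) / 2) × (2 ∣ k → m ≡ (k ^ n ∸ 2 ^ n) / 2)

IsMaximalNAS : ∀ {k} → ℕ → Sequence k → Set
IsMaximalNAS {k} n S = ∃[ m ] IsNAS n m S × IsMaximalPeriod k n m

{-# OPTIONS --safe #-}

-- Represent ℤ_k, k = 2r + 1, by the integers -r, …, r.  The k-ary sequence runs
-- through the four-letter blocks  b , x , b + 1 , - x  for x = 1, …, r and,
-- for each x, b = 0, …, x - 1.  The blocks with a given x form a closed walk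
-- through 0 which uses exactly one pair out of each {(u , v) , (- u , - v)} with
-- max (∣ u ∣ , ∣ v ∣) = x; a pair of consecutive letters determines its
-- block and its place in the block, and the total length is
-- 4 (1 + … + r) = (k ² - 1) / 2.
module Submission where

open import Defs
open import Data.Nat using (ℕ; zero; suc; pred; _+_; _*_; _∸_; _/_; _%_; _≤_; _<_; z≤n; s≤s; s≤s⁻¹; NonZero; ∣_-_∣; _≤?_; >-nonZero)
open import Data.Nat.Properties
open import Data.Nat.Divisibility using (divides; m%n≡0⇒n∣m)
open import Data.Nat.DivMod using (_mod_; m≡m%n+[m/n]*n; m%n<n; m<n⇒m%n≡m; /-monoˡ-≤; n%n≡0; [m+n]%n≡m%n; m*n/n≡m; %-distribˡ-+; m%n%n≡m%n)
open import Data.Nat.Tactic.RingSolver using (solve-∀)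
open import Data.Integer using (ℤ; +_; -[1+_]; -_; ∣_∣)
open import Data.Integer.Properties using (∣-i∣≡∣i∣)
open import Data.Fin using (toℕ)
open import Data.Fin.Properties using (toℕ-fromℕ<; toℕ-injective)
open import Data.Vec using (Vec; map)
open import Data.Vec.Properties using (∷-injective)
open import Data.Product using (∃-syntax; _×_; _,_; proj₁; proj₂; uncurry)
open import Data.Sum using (inj₁; inj₂)
open import Data.Empty using (⊥)
open import Function using (_∘_)
open import Relation.Nullary using (¬_; yes; no; contradiction)
open import Relation.Binary.PropositionalEquality

-- Triangular numbers.

tri : ℕ → ℕ
tri zero    = zero
tri (suc n) = tri n + suc n

tri-mono-≤ : ∀ {m n} → m ≤ n → tri m ≤ tri n
tri-mono-≤ z≤n       = z≤n
tri-mono-≤ (s≤s m≤n) = +-mono-≤ (tri-mono-≤ m≤n) (s≤s m≤n)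

tri-*2 : ∀ n → tri n * 2 ≡ n * suc n
tri-*2 zero    = refl
tri-*2 (suc n) = begin
  (tri n + suc n) * 2     ≡⟨ *-distribʳ-+ 2 (tri n) (suc n) ⟩
  tri n * 2 + suc n * 2   ≡⟨ cong (_+ suc n * 2) (tri-*2 n) ⟩
  n * suc n + suc n * 2   ≡⟨ identity n ⟩
  suc n * suc (suc n)     ∎
  where
  open ≡-Reasoning
  identity : ∀ n → n * suc n + suc n * 2 ≡ suc n * suc (suc n)
  identity = solve-∀

-- Enumeration of the blocks.

-- A block is given by b and d = x - 1 - b.
Block : Set
Block = ℕ × ℕ

nextBlock : Block → Block
nextBlock (b , suc d) = suc b , d
nextBlock (b , zero)  = zero , suc b

block : ℕ → Block
block zero    = zero , zero
block (suc n) = nextBlock (block n)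

-- With x = 1 + b + d, there are `tri (b + d)` blocks with smaller x, and b earlier blocks with the
-- same x.
blockIndex : Block → ℕ
blockIndex (b , d) = tri (b + d) + b

blockIndex-next : ∀ β → blockIndex (nextBlock β) ≡ suc (blockIndex β)
blockIndex-next (b , suc d) rewrite +-suc b d = +-suc _ b
blockIndex-next (b , zero)  rewrite +-identityʳ b | +-identityʳ (tri b + suc b) = +-suc (tri b) b

-- Starting at the first block with x = s + 1, each `nextBlock` moves one unit from d to b until d
-- is 0.
block-tri-+ : ∀ b {d s} → b + d ≡ s → block (tri s) ≡ (0 , s) →
              block (tri s + b) ≡ (b , d)
block-tri-+ zero    {s = s} refl eq = trans (cong block (+-identityʳ (tri s))) eq
block-tri-+ (suc b) {d} {s} b+d≡s eq = trans (cong block (+-suc (tri s) b))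
  (cong nextBlock (block-tri-+ b (trans (+-suc b d) b+d≡s) eq))

block-tri : ∀ r → block (tri r) ≡ (0 , r)
block-tri zero    = refl
block-tri (suc r) = trans (cong block (+-suc (tri r) r))
  (cong nextBlock (block-tri-+ r (+-identityʳ r) (block-tri r)))

-- Letters and positions along the walk.

data Place : Set where
  p₀ p₁ p₂ p₃ : Place

placeIndex : Place → ℕ
placeIndex p₀ = 0
placeIndex p₁ = 1
placeIndex p₂ = 2
placeIndex p₃ = 3

State : Set
State = Block × Place

next : State → State
next (β , p₀) = β , p₁
next (β , p₁) = β , p₂
next (β , p₂) = β , p₃
next (β , p₃) = nextBlock β , p₀

state : ℕ → State
state zero    = (0 , 0) , p₀
state (suc i) = next (state i)

letter : State → ℤ
letter ((b , d) , p₀) = + b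
letter ((b , d) , p₁) = + suc (b + d)
letter ((b , d) , p₂) = + suc b
letter ((b , d) , p₃) = -[1+ b + d ]

index : State → ℕ
index (β , p) = placeIndex p + blockIndex β * 4

index-next : ∀ s → index (next s) ≡ suc (index s)
index-next (β , p₀) = refl
index-next (β , p₁) = refl
index-next (β , p₂) = refl
index-next (β , p₃) = cong (_* 4) (blockIndex-next β)

index-state : ∀ i → index (state i) ≡ i
index-state zero    = refl
index-state (suc i) = trans (index-next (state i)) (cong suc (index-state i))

state-*4 : ∀ n → state (n * 4) ≡ (block n , p₀)
state-*4 zero    = refl
state-*4 (suc n) rewrite state-*4 n = refl

-- Pairs of consecutive letters.

-- Pairs which are not consecutive letters get junk values.
decode : ℤ → ℤ → ℕ
decode (+ u)    (+ zero)   = 0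
decode (+ u)    (+ suc v)  with u ≤? v
... | yes _ = (tri v + u) * 4
... | no  _ = 1 + (tri (pred u) + v) * 4
decode (+ u)    -[1+ v ]   = 2 + (tri v + pred u) * 4
decode -[1+ u ] (+ zero)   = 3 + (tri u + u) * 4
decode -[1+ u ] (+ suc v)  = 3 + (tri u + v) * 4
decode -[1+ u ] -[1+ v ]   = 0

-- The signs of the two letters give the place, except that `p₀` and `p₁` are told apart by size: b
-- < x at `p₀`, while x ≥ b + 1 at `p₁`.
decode-letter : ∀ s → decode (letter s) (letter (next s)) ≡ index s
decode-letter ((b , d) , p₀) with b ≤? b + d
... | yes _  = refl
... | no b≰b+d = contradiction (m≤m+n b d) b≰b+d
decode-letter ((b , d) , p₁) with suc (b + d) ≤? b
... | yes b+d<b = contradiction b+d<b (m+n≮m b d)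
... | no  _     = refl
decode-letter (β , p₂) = refl
-- In the last block with a given x the next letter is 0 rather than b + 1, so `decode` reads b off
-- x = b + 1 instead.
decode-letter ((b , zero)  , p₃) =
  cong (λ c → 3 + (tri (b + 0) + c) * 4) (+-identityʳ b)
decode-letter ((b , suc d) , p₃) = refl

-- A choice of one pair from each {(u , v) , (- u , - v)} other than (0 , 0), by a criterion that
-- does not mention blocks.
Edge : ℤ → ℤ → Set
Edge (+ u)    (+ v)    = 0 < v
Edge (+ u)    -[1+ v ] = 0 < u × u ≤ suc v
Edge -[1+ u ] (+ v)    = v ≤ u
Edge -[1+ u ] -[1+ v ] = ⊥

Edge-letter : ∀ s → Edge (letter s) (letter (next s))
Edge-letter (β , p₀) = s≤s z≤n
Edge-letter (β , p₁) = s≤s z≤n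
Edge-letter ((b , d) , p₂) = s≤s z≤n , s≤s (m≤m+n b d)
Edge-letter ((b , zero)  , p₃) = z≤n
Edge-letter ((b , suc d) , p₃) = ≤-trans (s≤s (m≤m+n b d)) (≤-reflexive (sym (+-suc b d)))

-- For opposite nonzero signs, `Edge` asks ∣ u ∣ ≤ ∣ v ∣ if the negative letter comes second and ∣ v
-- ∣ < ∣ u ∣ if it comes first. Any other pair turns into two negative letters, a second letter 0,
-- or 0 before a negative letter, all of which are excluded.
Edge-neg : ∀ u v → Edge u v → ¬ Edge (- u) (- v)
Edge-neg (+ zero)  (+ suc v) _           (() , _)
Edge-neg (+ suc u) (+ suc v) _           ()
Edge-neg (+ zero)  -[1+ v ]  (() , _)
Edge-neg (+ suc u) -[1+ v ]  (_ , u≤v)   v<u = <⇒≱ v<u (s≤s⁻¹ u≤v)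
Edge-neg -[1+ u ]  (+ zero)  _           ()
Edge-neg -[1+ u ]  (+ suc v) v<u         (_ , u≤v) = <⇒≱ v<u (s≤s⁻¹ u≤v)

-- Remainders and congruence.

%-≡⇒≡[mod] : ∀ m .{{_ : NonZero m}} {i j} → i % m ≡ j % m → i ≡ j [mod m ]
%-≡⇒≡[mod] m {i} {j} eq = divides ∣ i / m - j / m ∣ (begin
  ∣ i - j ∣                                     ≡⟨ cong₂ ∣_-_∣ (m≡m%n+[m/n]*n i m) (m≡m%n+[m/n]*n j m) ⟩
  ∣ i % m + i / m * m - j % m + j / m * m ∣     ≡⟨ cong (λ h → ∣ h + i / m * m - j % m + j / m * m ∣) eq ⟩
  ∣ j % m + i / m * m - j % m + j / m * m ∣     ≡⟨ ∣m+n-m+o∣≡∣n-o∣ (j % m) _ _ ⟩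
  ∣ i / m * m - j / m * m ∣                     ≡⟨ *-distribʳ-∣-∣ m (i / m) (j / m) ⟨
  ∣ i / m - j / m ∣ * m                         ∎)
  where open ≡-Reasoning

[1+i]%m : ∀ i m .{{_ : NonZero m}} → suc i % m ≡ suc (i % m) % m
[1+i]%m i m = trans (%-distribˡ-+ 1 i m)
  (trans (cong (λ h → (1 % m + h) % m) (sym (m%n%n≡m%n i m)))
         (sym (%-distribˡ-+ 1 (i % m) m)))

module Construction (r : ℕ) (0<r : 0 < r) where

  k : ℕ
  k = suc (r * 2)

  m : ℕ
  m = tri r * 4

  0<m : 0 < m
  0<m = *-mono-≤ {1} {tri r} {1} {4} (tri-mono-≤ 0<r) (s≤s z≤n)

  instance
    m≢0 : NonZero m
    m≢0 = >-nonZero 0<m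

  -- Least absolute residues modulo k.

  encode : ℤ → ℤmod k
  encode (+ n)    = n mod k
  encode -[1+ n ] = (k ∸ suc n) mod k

  -- Inverse of `encode` on -r, ..., r: a residue n > r stands for n - k = -(1 + (2r - n)).
  signed : ℕ → ℤ
  signed n with n ≤? r
  ... | yes _ = + n
  ... | no  _ = -[1+ r * 2 ∸ n ]

  toℕ-mod : ∀ {n} → n < k → toℕ (n mod k) ≡ n
  toℕ-mod {n} n<k = trans (toℕ-fromℕ< (m%n<n n k)) (m<n⇒m%n≡m n<k)

  r≤r*2 : r ≤ r * 2
  r≤r*2 = m≤m*n r 2

  signed-+ : ∀ {n} → n ≤ r → signed n ≡ + n
  signed-+ {n} n≤r with n ≤? r
  ... | yes _  = refl
  ... | no n≰r = contradiction n≤r n≰r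

  signed-- : ∀ {n} → n < r → signed (r * 2 ∸ n) ≡ -[1+ n ]
  signed-- {n} n<r with r * 2 ∸ n ≤? r
  ... | no  _  = cong -[1+_] (m∸[m∸n]≡n (≤-trans (<⇒≤ n<r) r≤r*2))
  ... | yes ≤r = contradiction ≤r (<⇒≱ (m+n≤o⇒m≤o∸n (suc r) (begin
    suc r + n   ≡⟨ +-suc r n ⟨
    r + suc n   ≤⟨ +-monoʳ-≤ r n<r ⟩
    r + r       ≡⟨ cong (_+_ r) (+-identityʳ r) ⟨
    2 * r       ≡⟨ *-comm 2 r ⟩
    r * 2       ∎)))
    where open ≤-Reasoning

  signed-encode : ∀ z → ∣ z ∣ ≤ r → signed (toℕ (encode z)) ≡ z
  signed-encode (+ n)    n≤r = trans (cong signed (toℕ-mod (s≤s (≤-trans n≤r r≤r*2)))) (signed-+ n≤r)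
  signed-encode -[1+ n ] n<r = trans (cong signed (toℕ-mod (s≤s (m∸n≤m (r * 2) n)))) (signed-- n<r)

  neg-encode : ∀ z → ∣ z ∣ ≤ r → neg (encode z) ≡ encode (- z)
  -- The one case in which `neg` wraps around: it forms k - 0 = k, and k mod k is 0.
  neg-encode (+ zero) _ = toℕ-injective (trans (toℕ-fromℕ< (m%n<n k k)) (n%n≡0 k))
  neg-encode (+ suc n) n≤r =
    cong (λ a → (k ∸ a) mod k) (toℕ-mod (s≤s (≤-trans n≤r r≤r*2)))
  neg-encode -[1+ n ] n<r = cong (_mod k) (begin
    k ∸ toℕ (encode -[1+ n ])   ≡⟨ cong (k ∸_) (toℕ-mod (s≤s (m∸n≤m (r * 2) n))) ⟩
    k ∸ (k ∸ suc n)             ≡⟨ m∸[m∸n]≡n (s≤s (≤-trans (<⇒≤ n<r) r≤r*2)) ⟩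
    suc n                       ∎)
    where open ≡-Reasoning

  -- Size of the letters and closure of the walk.

  b+d<r : ∀ s → index s < m → uncurry _+_ (proj₁ s) < r
  -- If b + d ≥ r, at least `tri r` blocks of four letters come before this one.
  b+d<r ((b , d) , p) s<m = ≰⇒> λ r≤b+d → <⇒≱ s<m (begin
    tri r * 4                                ≤⟨ *-monoˡ-≤ 4 (tri-mono-≤ r≤b+d) ⟩
    tri (b + d) * 4                          ≤⟨ *-monoˡ-≤ 4 (m≤m+n (tri (b + d)) b) ⟩
    (tri (b + d) + b) * 4                    ≤⟨ m≤n+m _ (placeIndex p) ⟩
    placeIndex p + (tri (b + d) + b) * 4     ∎)
    where open ≤-Reasoning

  ∣letter∣≤1+b+d : ∀ s → ∣ letter s ∣ ≤ suc (uncurry _+_ (proj₁ s))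
  ∣letter∣≤1+b+d ((b , d) , p₀) = ≤-trans (m≤m+n b d) (n≤1+n _)
  ∣letter∣≤1+b+d ((b , d) , p₁) = ≤-refl
  ∣letter∣≤1+b+d ((b , d) , p₂) = s≤s (m≤m+n b d)
  ∣letter∣≤1+b+d ((b , d) , p₃) = ≤-refl

  walk : ℕ → ℤ
  walk i = letter (state i)

  walk-m : walk m ≡ + 0
  walk-m = trans (cong letter (state-*4 (tri r))) (cong (λ β → letter (β , p₀)) (block-tri r))

  -- The end point i = m is included because the last pair of a period ends there; it lies in a
  -- block with x = r + 1, but its letter is 0.
  ∣walk∣≤r : ∀ {i} → i ≤ m → ∣ walk i ∣ ≤ r
  ∣walk∣≤r {i} i≤m with m≤n⇒m<n∨m≡n i≤m
  ... | inj₁ i<m  = ≤-trans (∣letter∣≤1+b+d (state i))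
                            (b+d<r (state i) (subst (_< m) (sym (index-state i)) i<m))
  ... | inj₂ refl = subst (λ z → ∣ z ∣ ≤ r) (sym walk-m) z≤n

  -- At i = m both sides are 0, so pairs across a period boundary are still consecutive letters of
  -- the walk.
  walk-% : ∀ {i} → i ≤ m → walk (i % m) ≡ walk i
  walk-% i≤m with m≤n⇒m<n∨m≡n i≤m
  ... | inj₁ i<m  = cong walk (m<n⇒m%n≡m i<m)
  ... | inj₂ refl = trans (cong walk (n%n≡0 m)) (sym walk-m)

  -- The periodic sequence.

  S : Sequence k
  S i = encode (walk (i % m))

  S-+1 : ∀ i → S (i + 1) ≡ encode (walk (suc (i % m)))
  S-+1 i = cong encode (begin
    walk ((i + 1) % m)        ≡⟨ cong (λ h → walk (h % m)) (+-comm i 1) ⟩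
    walk (suc i % m)          ≡⟨ cong walk ([1+i]%m i m) ⟩
    walk (suc (i % m) % m)    ≡⟨ walk-% (m%n<n i m) ⟩
    walk (suc (i % m))        ∎)
    where open ≡-Reasoning

  S-+0 : ∀ i → S (i + 0) ≡ encode (walk (i % m))
  S-+0 i = cong S (+-identityʳ i)

  ∣here∣≤r : ∀ i → ∣ walk (i % m) ∣ ≤ r
  ∣here∣≤r i = ∣walk∣≤r (<⇒≤ (m%n<n i m))

  ∣there∣≤r : ∀ i → ∣ walk (suc (i % m)) ∣ ≤ r
  ∣there∣≤r i = ∣walk∣≤r (m%n<n i m)

  -- Window property and negative avoidance.

  encode-injective : ∀ {y z} → ∣ y ∣ ≤ r → ∣ z ∣ ≤ r → encode y ≡ encode z → y ≡ z
  encode-injective {y} {z} y≤r z≤r eq =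
    trans (sym (signed-encode y y≤r)) (trans (cong (signed ∘ toℕ) eq) (signed-encode z z≤r))

  encode-neg-injective : ∀ {y z} → ∣ y ∣ ≤ r → ∣ z ∣ ≤ r → neg (encode y) ≡ encode z → - y ≡ z
  encode-neg-injective {y} y≤r z≤r eq = encode-injective
    (subst (_≤ r) (sym (∣-i∣≡∣i∣ y)) y≤r) z≤r (trans (sym (neg-encode y y≤r)) eq)

  -- Equal residues come from equal letters, from which `decode` recovers the position within the
  -- period.
  window : ∀ i j → tuple 2 S i ≡ tuple 2 S j → i ≡ j [mod m ]
  window i j eq with ∷-injective eq
  ... | eq₀ , eqs with ∷-injective eqs
  ... | eq₁ , _ = %-≡⇒≡[mod] m (begin
    i % m                                         ≡⟨ decode-walk (i % m) ⟨
    decode (walk (i % m)) (walk (suc (i % m)))    ≡⟨ cong₂ decode here there ⟩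
    decode (walk (j % m)) (walk (suc (j % m)))    ≡⟨ decode-walk (j % m) ⟩
    j % m                                         ∎)
    where
    open ≡-Reasoning
    decode-walk : ∀ n → decode (walk n) (walk (suc n)) ≡ n
    decode-walk n = trans (decode-letter (state n)) (index-state n)
    here : walk (i % m) ≡ walk (j % m)
    here = encode-injective (∣here∣≤r i) (∣here∣≤r j)
      (trans (sym (S-+0 i)) (trans eq₀ (S-+0 j)))
    there : walk (suc (i % m)) ≡ walk (suc (j % m))
    there = encode-injective (∣there∣≤r i) (∣there∣≤r j)
      (trans (sym (S-+1 i)) (trans eq₁ (S-+1 j)))

  -- Negated residues come from negated letters, so `Edge` would hold for a pair of letters and for
  -- its negative.
  negativeAvoiding : ∀ (a : Vec (ℤmod k) 2) → a OccursIn S → ¬ (map neg a OccursIn S)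
  negativeAvoiding _ (i , refl) (j , eq) with ∷-injective eq
  ... | eq₀ , eqs with ∷-injective eqs
  ... | eq₁ , _ = Edge-neg _ _ (Edge-letter (state (i % m)))
    (subst₂ Edge (sym here) (sym there) (Edge-letter (state (j % m))))
    where
    here : - walk (i % m) ≡ walk (j % m)
    here = encode-neg-injective (∣here∣≤r i) (∣here∣≤r j)
      (trans (cong neg (sym (S-+0 i))) (trans eq₀ (S-+0 j)))
    there : - walk (suc (i % m)) ≡ walk (suc (j % m))
    there = encode-neg-injective (∣there∣≤r i) (∣there∣≤r j)
      (trans (cong neg (sym (S-+1 i))) (trans eq₁ (S-+1 j)))

  -- The period.

  m≡[k^2-1]/2 : m ≡ (k * (k * 1) ∸ 1) / 2
  m≡[k^2-1]/2 = sym (trans (cong (_/ 2) k^2-1≡m*2) (m*n/n≡m m 2))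
    where
    open ≡-Reasoning
    -- This is k ^ 2 = 4 r (r + 1) + 1, with the power in unfolded form; r (r + 1) is twice `tri r`.
    identity : ∀ r → r * suc r * 4 + 1 ≡ suc (r * 2) * (suc (r * 2) * 1)
    identity = solve-∀
    *-swap : ∀ a → a * 2 * 4 ≡ a * 4 * 2
    *-swap = solve-∀
    k^2-1≡m*2 : k * (k * 1) ∸ 1 ≡ m * 2
    k^2-1≡m*2 = begin
      k * (k * 1) ∸ 1           ≡⟨ cong (_∸ 1) (identity r) ⟨
      r * suc r * 4 + 1 ∸ 1     ≡⟨ m+n∸n≡m (r * suc r * 4) 1 ⟩
      r * suc r * 4             ≡⟨ cong (_* 4) (tri-*2 r) ⟨
      tri r * 2 * 4             ≡⟨ *-swap (tri r) ⟩
      m * 2                     ∎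

  maximal : Odd k → IsMaximalNAS 2 S
  maximal odd = m , record
    { isWindowSequence = record
      { period-positive = 0<m
      ; periodic        = λ i → cong (encode ∘ walk) ([m+n]%n≡m%n i m)
      ; window          = window
      }
    ; negativeAvoiding = negativeAvoiding
    } , (λ _ → m≡[k^2-1]/2) , λ 2∣k → contradiction 2∣k odd

-- Arbitrary odd k.

odd⇒1+half*2 : ∀ k → Odd k → k ≡ suc (k / 2 * 2)
odd⇒1+half*2 k odd with k % 2 in eq | m%n<n k 2 | m≡m%n+[m/n]*n k 2
... | 0 | _ | _    = contradiction (m%n≡0⇒n∣m k 2 eq) odd
... | 1 | _ | k≡   = k≡
... | suc (suc _) | s≤s (s≤s ()) | _

theorem6p2 : ∀ (k : ℕ) → 3 ≤ k → Odd k → ∃[ S ] IsMaximalNAS {k} 2 S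
-- The construction has modulus 1 + 2 (k / 2), so sequence and oddness are transported together; 0 <
-- k / 2 comes from 3 / 2 = 1.
theorem6p2 k 3≤k odd = subst (λ k → Odd k → ∃[ S ] IsMaximalNAS {k} 2 S) (sym (odd⇒1+half*2 k odd))
  (λ odd′ → S , maximal odd′) odd
  where open Construction (k / 2) (/-monoˡ-≤ 2 3≤k) using (S; maximal)
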